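{- Let $n\geq 2$, $\delta\geq 0$, $k\geq 0$ and $m$ be integers with $2m\geq n\delta$. Then $$\max_{t\geq 1}\left\lceil f_t(n,m,\delta,k)\right\rceil\ =\ s^{\ast}(n,m,\delta,k)\ =\ \min\{\mathrm{sp}(D,k):D\in\mathcal{D}\},$$ where $\mathcal{D}$ is the set of all $\delta$-sequences of length $n$ with sum $2m$, and the maximum is over integers $t\ge 1$.
   Context: Put $h=k+1$. A $\delta$-sequence of length $n$ is a nondecreasing sequence $D=(d_1\leq\cdots\leq d_n)$ of integers with $d_1=\delta$. Its window number $\mathrm{sp}(D,k)$ is the largest number of its terms (counted with multiplicity) lying in an interval of $k+1$ consecutive integers. For integers $t\geq 1$, $$f_t(n,m,\delta,k)=\frac{2\left(n(\delta+t(k+1))-2m\right)}{(k+1)\,t(t+1)}.$$ For $1\leq s\leq n$ put $$\Sigma(n,s)=n\delta+h\sum_{i=1}^{n}\left\lfloor\frac{i-1}{s}\right\rfloor ,$$ and for $2m\geq n\delta$ let $s^{\ast}(n,m,\delta,k)=\min\{s\geq 1:\Sigma(n,s)\leq 2m\}$, which is well defined because $\Sigma(n,n)=n\delta$. -}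

module Defs where

open import Data.Integer.Base as ℤ using (ℤ; +_; 0ℤ)
import Data.Integer.Properties as ℤ
open import Data.List.Base using (List; head; length; filter; foldr; map; upTo)
open import Data.List.Relation.Unary.Sorted.TotalOrder ℤ.≤-totalOrder using (Sorted)
open import Data.Maybe.Base using (just)
open import Data.Nat.Base as ℕ using (ℕ; suc; NonZero)
open import Data.Nat.DivMod using (_/_)
open import Data.Nat.ListAction using (sum)
open import Data.Nat.Properties using (m*n≢0)
open import Data.Product.Base using (Σ-syntax; ∃-syntax; _×_)
open import Data.Rational.Unnormalised.Base as ℚᵘ using (ℚᵘ; ceiling)
open import Function.Base using (flip)
open import Level using (0ℓ)
open import Relation.Binary.Core using (Rel)
open import Relation.Binary.PropositionalEquality.Core using (_≡_)
open import Relation.Nullary.Decidable using (_×-dec_)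
open import Relation.Unary using (Pred; Decidable; _∈_)

IsGreatest : {A : Set} → Rel A 0ℓ → Pred A 0ℓ → Pred A 0ℓ
IsGreatest _≤_ P x = x ∈ P × (∀ y → y ∈ P → y ≤ x)

IsLeast : {A : Set} → Rel A 0ℓ → Pred A 0ℓ → Pred A 0ℓ
IsLeast _≤_ = IsGreatest (flip _≤_)

sumℤ : List ℤ → ℤ
sumℤ = foldr ℤ._+_ 0ℤ

record IsδSequence (δ : ℤ) (n : ℕ) (D : List ℤ) : Set where
  field
    length≡ : length D ≡ n
    sorted  : Sorted D
    first   : head D ≡ just δ

InWindow : ℤ → ℕ → Pred ℤ 0ℓ
InWindow a k d = a ℤ.≤ d × d ℤ.≤ a ℤ.+ + k

inWindow? : ∀ a k → Decidable (InWindow a k)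
inWindow? a k d = (a ℤ.≤? d) ×-dec (d ℤ.≤? a ℤ.+ + k)

windowCount : List ℤ → ℕ → ℤ → ℕ
windowCount D k a = length (filter (inWindow? a k) D)

-- IsWindowNumber D k w encodes w = sp(D, k), taken over windows a, …, a + k with a ∈ ℤ.
IsWindowNumber : List ℤ → ℕ → Pred ℕ 0ℓ
IsWindowNumber D k = IsGreatest ℕ._≤_ λ c → ∃[ a ] windowCount D k a ≡ c

WindowNumbers : ℕ → ℤ → ℤ → ℕ → Pred ℕ 0ℓ
WindowNumbers n m δ k w =
  ∃[ D ] IsδSequence δ n D × sumℤ D ≡ + 2 ℤ.* m × IsWindowNumber D k w

f : (t : ℕ) .{{_ : NonZero t}} → ℕ → ℤ → ℤ → ℕ → ℚᵘ
f t n m δ k =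
  (+ 2 ℤ.* (+ n ℤ.* (δ ℤ.+ + (t ℕ.* suc k)) ℤ.- + 2 ℤ.* m))
    ℚᵘ./ (suc k ℕ.* (t ℕ.* suc t))
  where instance
    t[1+t]≢0 : NonZero (t ℕ.* suc t)
    t[1+t]≢0 = m*n≢0 t (suc t)

    denominator≢0 : NonZero (suc k ℕ.* (t ℕ.* suc t))
    denominator≢0 = m*n≢0 (suc k) (t ℕ.* suc t)

Ceilings : ℕ → ℤ → ℤ → ℕ → Pred ℤ 0ℓ
Ceilings n m δ k c =
  ∃[ t ] Σ[ t≢0 ∈ NonZero t ] ceiling (f t {{t≢0}} n m δ k) ≡ c

-- Σ(n, s) for h = k + 1; the list index j is i - 1.
staircaseSum : ℤ → ℕ → ℕ → (s : ℕ) .{{_ : NonZero s}} → ℤ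
staircaseSum δ k n s =
  + n ℤ.* δ ℤ.+ + (suc k ℕ.* sum (map (λ j → j / s) (upTo n)))

-- s* is the least element of this set; Σ(n, s) is defined for 1 ≤ s ≤ n.
Feasible : ℕ → ℤ → ℤ → ℕ → Pred ℕ 0ℓ
Feasible n m δ k s =
  Σ[ s≢0 ∈ NonZero s ]
    (s ℕ.≤ n × staircaseSum δ k n s {{s≢0}} ℤ.≤ + 2 ℤ.* m)

{-# OPTIONS --safe #-}

-- Put h = k + 1 and S = ∑_{j < n} ⌊j / s⌋. Since ∑_{i ≤ t} (n - i s) = n t - s t (t + 1) / 2 is at most S, with
-- equality at t = ⌊n / s⌋, the inequality h S ≤ 2m - nδ says exactly that f_t ≤ s for every t ≥ 1; so s is feasible
-- iff it bounds all the ceilings. In a sorted sequence with window number w, terms w places apart differ by at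
-- least h, so the sequence dominates the staircase δ + h ⌊j / w⌋ and w is feasible. Conversely, for the least
-- feasible s, adding the missing 2m - Σ(n, s) to the last term of the staircase gives a sequence with window number s.
module Submission where

open import Defs
open import Data.Bool.Base using (true; false)
open import Data.Integer.Base as ℤ using (ℤ; +_; 0ℤ)
import Data.Integer.DivMod as ℤ
import Data.Integer.Properties as ℤ
import Data.Integer.Tactic.RingSolver as ℤ
open import Data.List.Base using (List; []; _∷_; _∷ʳ_; applyUpTo; filter; length)
open import Data.List.Properties
  using (applyUpTo-∷ʳ; filter-accept; filter-reject; length-applyUpTo; length-filter; map-upTo)
open import Data.List.Relation.Unary.Linked using (_∷_)
open import Data.List.Relation.Unary.Sorted.TotalOrder ℤ.≤-totalOrder using (Sorted)
open import Data.List.Relation.Unary.Sorted.TotalOrder.Properties using (applyUpTo⁺₂)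
open import Data.Maybe.Base using (just)
open import Data.Nat.Base as ℕ using (ℕ; zero; suc; NonZero; _+_; _*_; _∸_; _≤_; _<_; z≤n; s≤s)
open import Data.Nat.DivMod
open import Data.Nat.Induction using (<-rec)
open import Data.Nat.ListAction using (sum)
open import Data.Nat.ListAction.Properties using (sum-++)
open import Data.Nat.Properties
open import Data.Nat.Tactic.RingSolver using (solve-∀)
open import Data.Product.Base using (Σ-syntax; ∃; ∃-syntax; _×_; _,_; map₂; proj₁; proj₂)
open import Data.Rational.Unnormalised.Base as ℚᵘ using (ceiling)
open import Data.Sum.Base using (_⊎_; inj₁; inj₂; [_,_]′)
open import Function.Base using (_∘_)
open import Level using (0ℓ)
open import Relation.Binary.PropositionalEquality
open import Relation.Nullary using (¬_; contradiction)
open import Relation.Nullary.Decidable using (yes; no; map′; _because_; _×-dec_)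
open import Relation.Unary using (Pred; Decidable; _∈_)

-- Sums over initial segments of ℕ

sum-applyUpTo-+ : ∀ f g n →
  sum (applyUpTo (λ j → f j + g j) n) ≡ sum (applyUpTo f n) + sum (applyUpTo g n)
sum-applyUpTo-+ f g zero    = refl
sum-applyUpTo-+ f g (suc n) = trans (cong (λ x → f 0 + g 0 + x) (sum-applyUpTo-+ (f ∘ suc) (g ∘ suc) n))
  (lemma (f 0) (g 0) _ _)
  where
  lemma : ∀ a b c d → a + b + (c + d) ≡ a + c + (b + d)
  lemma = solve-∀

sum-applyUpTo-* : ∀ c f n → sum (applyUpTo (λ j → c * f j) n) ≡ c * sum (applyUpTo f n)
sum-applyUpTo-* c f zero    = sym (*-zeroʳ c)
sum-applyUpTo-* c f (suc n) = trans (cong (λ x → c * f 0 + x) (sum-applyUpTo-* c (f ∘ suc) n))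
  (sym (*-distribˡ-+ c (f 0) _))

sumℤ-applyUpTo-mono-≤ : ∀ f g n → (∀ j → j < n → f j ℤ.≤ g j) →
  sumℤ (applyUpTo f n) ℤ.≤ sumℤ (applyUpTo g n)
sumℤ-applyUpTo-mono-≤ f g zero    f≤g = ℤ.≤-refl
sumℤ-applyUpTo-mono-≤ f g (suc n) f≤g = ℤ.+-mono-≤ (f≤g 0 (s≤s z≤n))
  (sumℤ-applyUpTo-mono-≤ (f ∘ suc) (g ∘ suc) n (λ j j<n → f≤g (suc j) (s≤s j<n)))

sumℤ-applyUpTo-offset : ∀ δ o n →
  sumℤ (applyUpTo (λ j → δ ℤ.+ + o j) n) ≡ + n ℤ.* δ ℤ.+ + sum (applyUpTo o n)
sumℤ-applyUpTo-offset δ o zero    = refl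
sumℤ-applyUpTo-offset δ o (suc n) =
  trans (cong (λ x → δ ℤ.+ + o 0 ℤ.+ x) (sumℤ-applyUpTo-offset δ (o ∘ suc) n))
        (lemma (+ n) δ (+ o 0) _)
  where
  lemma : ∀ n δ a b → δ ℤ.+ a ℤ.+ (n ℤ.* δ ℤ.+ b) ≡ (+ 1 ℤ.+ n) ℤ.* δ ℤ.+ (a ℤ.+ b)
  lemma = ℤ.solve-∀

sum-applyUpTo-suc : ∀ f n → sum (applyUpTo f (suc n)) ≡ sum (applyUpTo f n) + f n
sum-applyUpTo-suc f n = begin
  sum (applyUpTo f (suc n))     ≡⟨ cong sum (applyUpTo-∷ʳ f n) ⟨
  sum (applyUpTo f n ∷ʳ f n)    ≡⟨ sum-++ (applyUpTo f n) (f n ∷ []) ⟩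
  sum (applyUpTo f n) + (f n + 0) ≡⟨ cong (λ x → sum (applyUpTo f n) + x) (+-identityʳ (f n)) ⟩
  sum (applyUpTo f n) + f n     ∎
  where open ≡-Reasoning

-- Sums of the quotients ⌊j / s⌋

-- With h = k + 1, h times this number is the excess of Σ(n, s) over nδ.
quotientSum : ℕ → (s : ℕ) .{{_ : NonZero s}} → ℕ
quotientSum n s = sum (applyUpTo (_/ s) n)

quotientSum-≤ : ∀ n s .{{_ : NonZero s}} → n ≤ s → quotientSum n s ≡ 0
quotientSum-≤ zero    s _   = refl
quotientSum-≤ (suc n) s n<s = begin
  quotientSum (suc n) s    ≡⟨ sum-applyUpTo-suc (_/ s) n ⟩
  quotientSum n s + n / s  ≡⟨ cong₂ _+_ (quotientSum-≤ n s (<⇒≤ n<s)) (m<n⇒m/n≡0 n<s) ⟩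
  0                        ∎
  where open ≡-Reasoning

[n+m]/n≡1+m/n : ∀ n m .{{_ : NonZero n}} → (n + m) / n ≡ suc (m / n)
[n+m]/n≡1+m/n n m = trans (m/n≡1+[m∸n]/n (m≤m+n n m)) (cong (λ x → suc (x / n)) (m+n∸m≡n n m))

-- The first block of `s` indices has quotient 0, and shifting an index by `s` raises its quotient
-- by one, so the `n` shifted indices contribute `n` more.
quotientSum-+ : ∀ n s .{{_ : NonZero s}} → quotientSum (s + n) s ≡ n + quotientSum n s
quotientSum-+ zero    s = trans (cong (λ x → quotientSum x s) (+-identityʳ s)) (quotientSum-≤ s s ≤-refl)
quotientSum-+ (suc n) s = begin
  quotientSum (s + suc n) s               ≡⟨ cong (λ x → quotientSum x s) (+-suc s n) ⟩
  quotientSum (suc (s + n)) s             ≡⟨ sum-applyUpTo-suc (_/ s) (s + n) ⟩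
  quotientSum (s + n) s + (s + n) / s     ≡⟨ cong₂ _+_ (quotientSum-+ n s) ([n+m]/n≡1+m/n s n) ⟩
  n + quotientSum n s + suc (n / s)       ≡⟨ lemma n _ _ ⟩
  suc n + (quotientSum n s + n / s)       ≡⟨ cong (λ x → suc n + x) (sum-applyUpTo-suc (_/ s) n) ⟨
  suc n + quotientSum (suc n) s           ∎
  where
  open ≡-Reasoning
  lemma : ∀ a b c → a + b + suc c ≡ suc a + (b + c)
  lemma = solve-∀

module _ (s : ℕ) .{{_ : NonZero s}} where

  private
    -- Both sides of nt ≤ S + st(t + 1)/2, doubled to avoid the division. `increment` is what either
    -- side gains when `n` grows by `s` and `t` by one.
    lhs rhs increment : ℕ → ℕ → ℕ
    lhs n t = 2 * (n * t)
    rhs n t = 2 * quotientSum n s + s * (t * suc t)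
    increment n t = 2 * n + 2 * (s * suc t)

    lhs-shift : ∀ n t → lhs (s + n) (suc t) ≡ lhs n t + increment n t
    lhs-shift = lemma s
      where
      lemma : ∀ s n t → 2 * ((s + n) * suc t) ≡ 2 * (n * t) + (2 * n + 2 * (s * suc t))
      lemma = solve-∀

    rhs-shift : ∀ n t → rhs (s + n) (suc t) ≡ rhs n t + increment n t
    rhs-shift n t = trans (cong (λ x → 2 * x + s * (suc t * suc (suc t))) (quotientSum-+ n s))
      (lemma s n t (quotientSum n s))
      where
      lemma : ∀ s n t S → 2 * (n + S) + s * (suc t * suc (suc t)) ≡
                          2 * S + s * (t * suc t) + (2 * n + 2 * (s * suc t))
      lemma = solve-∀

    -- Removing one block from n = qs + r and one unit from `t` lowers both sides equally. The
    -- descent stops at t = 0, where the left side vanishes, or at n = r < s with t ≥ 1, where 2rt ≤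
    -- 2st ≤ st(t + 1).
    lhs≤rhs-blocks : ∀ q r t → r < s → lhs (q * s + r) t ≤ rhs (q * s + r) t
    lhs≤rhs-blocks q       r zero    _ = ≤-trans (≤-reflexive (lemma (q * s + r))) z≤n
      where
      lemma : ∀ a → 2 * (a * 0) ≡ 0
      lemma = solve-∀
    lhs≤rhs-blocks zero    r t@(suc _) r<s = begin
      2 * (r * t)      ≤⟨ *-monoʳ-≤ 2 (*-monoˡ-≤ t (<⇒≤ r<s)) ⟩
      2 * (s * t)      ≤⟨ *-monoˡ-≤ (s * t) {2} {suc t} (s≤s (s≤s z≤n)) ⟩
      suc t * (s * t)  ≡⟨ lemma s t ⟩
      s * (t * suc t)  ≤⟨ m≤n+m _ _ ⟩
      rhs r t          ∎
      where
      open ≤-Reasoning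
      lemma : ∀ a b → suc b * (a * b) ≡ a * (b * suc b)
      lemma = solve-∀
    lhs≤rhs-blocks (suc q) r (suc t) r<s = begin
      lhs (s + q * s + r) (suc t)   ≡⟨ cong (λ x → lhs x (suc t)) (+-assoc s (q * s) r) ⟩
      lhs (s + n) (suc t)           ≡⟨ lhs-shift n t ⟩
      lhs n t + increment n t       ≤⟨ +-monoˡ-≤ (increment n t) (lhs≤rhs-blocks q r t r<s) ⟩
      rhs n t + increment n t       ≡⟨ rhs-shift n t ⟨
      rhs (s + n) (suc t)           ≡⟨ cong (λ x → rhs x (suc t)) (+-assoc s (q * s) r) ⟨
      rhs (s + q * s + r) (suc t)   ∎
      where
      open ≤-Reasoning
      n = q * s + r

    -- For t = q the blocks and the units of `t` run out together, and then both sides are 0.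
    lhs≡rhs-blocks : ∀ q r → r < s → lhs (q * s + r) q ≡ rhs (q * s + r) q
    lhs≡rhs-blocks zero r r<s = begin
      2 * (r * 0)      ≡⟨ lemma r s ⟩
      2 * 0 + s * 0    ≡⟨ cong (λ x → 2 * x + s * 0) (quotientSum-≤ r s (<⇒≤ r<s)) ⟨
      rhs r 0          ∎
      where
      open ≡-Reasoning
      lemma : ∀ r s → 2 * (r * 0) ≡ 2 * 0 + s * 0
      lemma = solve-∀
    lhs≡rhs-blocks (suc q) r r<s = begin
      lhs (s + q * s + r) (suc q)   ≡⟨ cong (λ x → lhs x (suc q)) (+-assoc s (q * s) r) ⟩
      lhs (s + n) (suc q)           ≡⟨ lhs-shift n q ⟩
      lhs n q + increment n q       ≡⟨ cong (λ x → x + increment n q) (lhs≡rhs-blocks q r r<s) ⟩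
      rhs n q + increment n q       ≡⟨ rhs-shift n q ⟨
      rhs (s + n) (suc q)           ≡⟨ cong (λ x → rhs x (suc q)) (+-assoc s (q * s) r) ⟨
      rhs (s + q * s + r) (suc q)   ∎
      where
      open ≡-Reasoning
      n = q * s + r

    divMod : ∀ n → n / s * s + n % s ≡ n
    divMod n = trans (+-comm (n / s * s) (n % s)) (sym (m≡m%n+[m/n]*n n s))

  2nt≤2quotientSum+st[1+t] : ∀ n t →
    2 * (n * t) ≤ 2 * quotientSum n s + s * (t * suc t)
  2nt≤2quotientSum+st[1+t] n t = subst (λ x → lhs x t ≤ rhs x t) (divMod n)
    (lhs≤rhs-blocks (n / s) (n % s) t (m%n<n n s))

  2nq≡2quotientSum+sq[1+q] : ∀ n → let q = n / s in
    2 * (n * q) ≡ 2 * quotientSum n s + s * (q * suc q)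
  2nq≡2quotientSum+sq[1+q] n = subst (λ x → lhs x (n / s) ≡ rhs x (n / s)) (divMod n)
    (lhs≡rhs-blocks (n / s) (n % s) (m%n<n n s))

-- Bounds on the ceiling of a fraction

-- The ceiling of a / d is computed as -q, where q is the floor of -a / d. From -cd ≤ -a < (q + 1)d
-- follows -c ≤ q.
ceiling-≤ : ∀ a d c .{{_ : NonZero d}} → a ℤ.≤ c ℤ.* + d → ceiling (a ℚᵘ./ d) ℤ.≤ c
ceiling-≤ a d@(suc _) c a≤cd = subst (ceiling (a ℚᵘ./ d) ℤ.≤_) (ℤ.neg-involutive c)
  (ℤ.neg-mono-≤ {ℤ.- c} {q} -c≤q)
  where
  q = ℤ.- a ℤ./ + d
  -cd<[1+q]d : ℤ.- c ℤ.* + d ℤ.< ℤ.suc q ℤ.* + d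
  -cd<[1+q]d = begin-strict
    ℤ.- c ℤ.* + d             ≡⟨ ℤ.neg-distribˡ-* c (+ d) ⟨
    ℤ.- (c ℤ.* + d)           ≤⟨ ℤ.neg-mono-≤ a≤cd ⟩
    ℤ.- a                     <⟨ ℤ.n<s[n/ℕd]*d (ℤ.- a) d ⟩
    ℤ.suc (ℤ.- a ℤ./ℕ d) ℤ.* + d ≡⟨ cong (λ x → ℤ.suc x ℤ.* + d) (ℤ.div-pos-is-/ℕ (ℤ.- a) d) ⟨
    ℤ.suc q ℤ.* + d           ∎
    where open ℤ.≤-Reasoning
  -c≤q : ℤ.- c ℤ.≤ q
  -c≤q = subst (ℤ.- c ℤ.≤_) (ℤ.pred-suc q) (ℤ.i<j⇒i≤pred[j] {ℤ.- c} {ℤ.suc q} (ℤ.*-cancelʳ-<-nonNeg {ℤ.- c} {ℤ.suc q} (+ d) -cd<[1+q]d))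

-- With the same q, the chain qd ≤ -a < -cd gives q < -c.
<-ceiling : ∀ a d c .{{_ : NonZero d}} → c ℤ.* + d ℤ.< a → c ℤ.< ceiling (a ℚᵘ./ d)
<-ceiling a d@(suc _) c cd<a = subst (ℤ._< ceiling (a ℚᵘ./ d)) (ℤ.neg-involutive c)
  (ℤ.neg-mono-< {q} {ℤ.- c} (ℤ.*-cancelʳ-<-nonNeg {q} {ℤ.- c} (+ d) qd<-cd))
  where
  q = ℤ.- a ℤ./ + d
  qd<-cd : q ℤ.* + d ℤ.< ℤ.- c ℤ.* + d
  qd<-cd = begin-strict
    q ℤ.* + d          ≤⟨ ℤ.[n/d]*d≤n (ℤ.- a) (+ d) ⟩
    ℤ.- a              <⟨ ℤ.neg-mono-< cd<a ⟩
    ℤ.- (c ℤ.* + d)    ≡⟨ ℤ.neg-distribˡ-* c (+ d) ⟩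
    ℤ.- c ℤ.* + d      ∎
    where open ℤ.≤-Reasoning

-- Least elements, and counting in filtered lists

least : ∀ {P : Pred ℕ 0ℓ} → Decidable P → ∀ n → P n → ∃ (IsLeast _≤_ P)
least {P} P? = <-rec (λ n → P n → ∃ (IsLeast _≤_ P)) step
  where
  step : ∀ n → (∀ {i} → i < n → P i → ∃ (IsLeast _≤_ P)) → P n → ∃ (IsLeast _≤_ P)
  step n rec Pn with anyUpTo? P? n
  ... | yes (i , i<n , Pi) = rec i<n Pi
  ... | no ¬smaller = n , Pn , λ i Pi → ≮⇒≥ (λ i<n → ¬smaller (i , i<n , Pi))

module _ {A : Set} {P : Pred A 0ℓ} (P? : Decidable P) where

  length-filter-applyUpTo-≤ : ∀ f n c → (∀ j → c ≤ j → ¬ P (f j)) →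
    length (filter P? (applyUpTo f n)) ≤ c
  length-filter-applyUpTo-≤ f zero    c       ¬Pf = z≤n
  length-filter-applyUpTo-≤ f (suc n) zero    ¬Pf
    rewrite filter-reject P? {xs = applyUpTo (f ∘ suc) n} (¬Pf 0 z≤n) =
    length-filter-applyUpTo-≤ (f ∘ suc) n zero (λ j _ → ¬Pf (suc j) z≤n)
  length-filter-applyUpTo-≤ f (suc n) (suc c) ¬Pf
    with ih ← length-filter-applyUpTo-≤ (f ∘ suc) n c (λ j c≤j → ¬Pf (suc j) (s≤s c≤j)) | P? (f 0)
  ... | true  because _ = s≤s ih
  ... | false because _ = m≤n⇒m≤1+n ih

  length-filter-applyUpTo-≥ : ∀ f n i c → i + c ≤ n →
    (∀ j → i ≤ j → j < i + c → P (f j)) → c ≤ length (filter P? (applyUpTo f n))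
  length-filter-applyUpTo-≥ f n       i       zero    _         Pf = z≤n
  length-filter-applyUpTo-≥ f (suc n) zero    (suc c) (s≤s c≤n) Pf
    rewrite filter-accept P? {xs = applyUpTo (f ∘ suc) n} (Pf 0 z≤n (s≤s z≤n)) =
    s≤s (length-filter-applyUpTo-≥ (f ∘ suc) n zero c c≤n
      (λ j _ j<c → Pf (suc j) z≤n (s≤s j<c)))
  length-filter-applyUpTo-≥ f (suc n) (suc i) (suc c) (s≤s i+c≤n) Pf
    with ih ← length-filter-applyUpTo-≥ (f ∘ suc) n i (suc c) i+c≤n
                (λ j i≤j j<i+c → Pf (suc j) (s≤s i≤j) (s≤s j<i+c)) | P? (f 0)
  ... | true  because _ = m≤n⇒m≤1+n ih
  ... | false because _ = ih

-- Window numbers and gaps in monotone sequences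

-- Past the end of the list the last element is repeated, so that sortedness gives monotonicity on all of ℕ.
entry : ℤ → List ℤ → ℕ → ℤ
entry x xs       zero    = x
entry x []       (suc j) = x
entry x (y ∷ ys) (suc j) = entry y ys j

applyUpTo-entry : ∀ x xs → applyUpTo (entry x xs) (suc (length xs)) ≡ x ∷ xs
applyUpTo-entry x []       = refl
applyUpTo-entry x (y ∷ ys) = cong (x ∷_) (applyUpTo-entry y ys)

entry-mono-≤ : ∀ x xs → Sorted (x ∷ xs) → ∀ {i j} → i ≤ j → entry x xs i ℤ.≤ entry x xs j
entry-mono-≤ x xs       _           {zero}  {zero}  _         = ℤ.≤-refl
entry-mono-≤ x []       _           {zero}  {suc j} _         = ℤ.≤-refl
entry-mono-≤ x []       _           {suc i} {suc j} _         = ℤ.≤-refl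
entry-mono-≤ x (y ∷ ys) (x≤y ∷ ys↗) {zero}  {suc j} _         =
  ℤ.≤-trans x≤y (entry-mono-≤ y ys ys↗ {0} {j} z≤n)
entry-mono-≤ x (y ∷ ys) (_   ∷ ys↗) {suc i} {suc j} (s≤s i≤j) = entry-mono-≤ y ys ys↗ i≤j

i<j+[1+k]⇒i≤j+k : ∀ {i} j k → i ℤ.< j ℤ.+ + suc k → i ℤ.≤ j ℤ.+ + k
i<j+[1+k]⇒i≤j+k {i} j k i<j+1+k =
  subst (i ℤ.≤_) (lemma j (+ k)) (ℤ.i<j⇒i≤pred[j] i<j+1+k)
  where
  lemma : ∀ j k → ℤ.- (+ 1) ℤ.+ (j ℤ.+ (+ 1 ℤ.+ k)) ≡ j ℤ.+ k
  lemma = ℤ.solve-∀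

module _ (d : ℕ → ℤ) (n k w : ℕ) (d-mono : ∀ {i j} → i ≤ j → d i ℤ.≤ d j)
         (count≤w : ∀ a → windowCount (applyUpTo d n) k a ≤ w) where

  -- Otherwise the w + 1 terms from `d i` to `d (i + w)` would all lie in the window that starts at
  -- `d i`.
  windowCount≤⇒spread : ∀ i → i + w < n → d i ℤ.+ + suc k ℤ.≤ d (i + w)
  windowCount≤⇒spread i i+w<n = ℤ.≮⇒≥ λ d[i+w]<di+1+k → contradiction
    (length-filter-applyUpTo-≥ (inWindow? (d i) k) d n i (suc w)
      (subst (_≤ n) (sym (+-suc i w)) i+w<n)
      (λ j i≤j j<i+1+w → d-mono i≤j ,
        ℤ.≤-trans (d-mono (m<1+n⇒m≤n (subst (j <_) (+-suc i w) j<i+1+w)))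
                  (i<j+[1+k]⇒i≤j+k (d i) k d[i+w]<di+1+k)))
    (≤⇒≯ (count≤w (d i)))

  -- Strong induction in strides of `w`: each stride raises the quotient by one and the term by at
  -- least k + 1. Below `w` the staircase is flat, and monotonicity suffices.
  windowCount≤⇒staircase≤ : .{{_ : NonZero w}} → ∀ j → j < n →
    d 0 ℤ.+ + (suc k * (j / w)) ℤ.≤ d j
  windowCount≤⇒staircase≤ = <-rec _ step
    where
    open ℤ.≤-Reasoning
    step : ∀ j → (∀ {i} → i < j → i < n → d 0 ℤ.+ + (suc k * (i / w)) ℤ.≤ d i) →
           j < n → d 0 ℤ.+ + (suc k * (j / w)) ℤ.≤ d j
    step j rec j<n with j <? w
    ... | yes j<w = begin
      d 0 ℤ.+ + (suc k * (j / w))  ≡⟨ cong (λ x → d 0 ℤ.+ + (suc k * x)) (m<n⇒m/n≡0 j<w) ⟩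
      d 0 ℤ.+ + (suc k * 0)        ≡⟨ cong (λ x → d 0 ℤ.+ + x) (*-zeroʳ (suc k)) ⟩
      d 0 ℤ.+ 0ℤ                   ≡⟨ ℤ.+-identityʳ (d 0) ⟩
      d 0                          ≤⟨ d-mono z≤n ⟩
      d j                          ∎
    ... | no  j≮w = begin
      d 0 ℤ.+ + (suc k * (j / w))                   ≡⟨ cong (λ x → d 0 ℤ.+ + (suc k * x)) (m/n≡1+[m∸n]/n w≤j) ⟩
      d 0 ℤ.+ + (suc k * suc (i / w))               ≡⟨ cong (λ x → d 0 ℤ.+ + x) (trans (*-suc (suc k) (i / w)) (+-comm (suc k) (suc k * (i / w)))) ⟩
      d 0 ℤ.+ (+ (suc k * (i / w)) ℤ.+ + suc k)     ≡⟨ ℤ.+-assoc (d 0) _ _ ⟨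
      d 0 ℤ.+ + (suc k * (i / w)) ℤ.+ + suc k       ≤⟨ ℤ.+-monoˡ-≤ (+ suc k) (rec i<j (<-trans i<j j<n)) ⟩
      d i ℤ.+ + suc k                               ≤⟨ windowCount≤⇒spread i (subst (_< n) (sym i+w≡j) j<n) ⟩
      d (i + w)                                     ≡⟨ cong d i+w≡j ⟩
      d j                                           ∎
      where
      w≤j = ≮⇒≥ j≮w
      i = j ∸ w
      i+w≡j = m∸n+n≡m w≤j
      i<j : i < j
      i<j = ∸-monoʳ-< {m = j} {n = w} {o = 0} (ℕ.>-nonZero⁻¹ w) w≤j

-- Leading terms outside the window are dropped. Once `d 0` lies in it, every term from index `s` on
-- is at least d 0 + k + 1 > a + k, so at most the first `s` terms count.
spread⇒windowCount≤ : ∀ d n k s → (∀ i j → i + s ≤ j → d i ℤ.+ + suc k ℤ.≤ d j) →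
  ∀ a → windowCount (applyUpTo d n) k a ≤ s
spread⇒windowCount≤ d zero    k s spread a = z≤n
spread⇒windowCount≤ d (suc n) k s spread a with inWindow? a k (d 0)
... | no d0∉ rewrite filter-reject (inWindow? a k) {xs = applyUpTo (d ∘ suc) n} d0∉ =
  spread⇒windowCount≤ (d ∘ suc) n k s (λ i j i+s≤j → spread (suc i) (suc j) (s≤s i+s≤j)) a
... | yes (a≤d0 , _) = length-filter-applyUpTo-≤ (inWindow? a k) d (suc n) s λ j s≤j (_ , dj≤a+k) →
  ℤ.<-irrefl refl (begin-strict
    a ℤ.+ + k        <⟨ ℤ.+-monoʳ-< a (ℤ.+<+ ≤-refl) ⟩
    a ℤ.+ + suc k    ≤⟨ ℤ.+-monoˡ-≤ (+ suc k) a≤d0 ⟩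
    d 0 ℤ.+ + suc k  ≤⟨ spread 0 j s≤j ⟩
    d j              ≤⟨ dj≤a+k ⟩
    a ℤ.+ + k        ∎)
  where open ℤ.≤-Reasoning

-- The raised staircase

-- In a list of n + 1 terms this is `e` at the last index and 0 before it. It keeps the value `e`
-- from there on, so that it is monotone on all of ℕ.
bump : ℕ → ℕ → ℕ → ℕ
bump zero    e _       = e
bump (suc n) e zero    = 0
bump (suc n) e (suc j) = bump n e j

bump-mono-≤ : ∀ n e {i j} → i ≤ j → bump n e i ≤ bump n e j
bump-mono-≤ zero    e _         = ≤-refl
bump-mono-≤ (suc n) e z≤n       = z≤n
bump-mono-≤ (suc n) e (s≤s i≤j) = bump-mono-≤ n e i≤j

bump-< : ∀ n e {j} → j < n → bump n e j ≡ 0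
bump-< (suc n) e {zero}  _         = refl
bump-< (suc n) e {suc j} (s≤s j<n) = bump-< n e j<n

bump≤ : ∀ n e j → bump n e j ≤ e
bump≤ zero    e _       = ≤-refl
bump≤ (suc n) e zero    = z≤n
bump≤ (suc n) e (suc j) = bump≤ n e j

sum-bump : ∀ n e → sum (applyUpTo (bump n e) (suc n)) ≡ e
sum-bump zero    e = +-identityʳ e
sum-bump (suc n) e = sum-bump n e

-- The sequence dominates the staircase of step width `w` term by term; summing gives the bound.
-- Since `w` is attained as a count, it is at most the length.
windowNumber⇒staircaseSum≤ : ∀ {n δ D} k w → .{{_ : NonZero n}} → IsδSequence δ n D → IsWindowNumber D k w →
  Σ[ w≢0 ∈ NonZero w ] (w ≤ n × + n ℤ.* δ ℤ.+ + (suc k * quotientSum n w {{w≢0}}) ℤ.≤ sumℤ D)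
windowNumber⇒staircaseSum≤ {D = x ∷ xs} k w record { length≡ = refl ; sorted = D↗ ; first = refl } ((a , count≡w) , count≤w) =
  w≢0 , subst (_≤ n) count≡w (length-filter (inWindow? a k) (x ∷ xs)) , (begin
    + n ℤ.* x ℤ.+ + (suc k * quotientSum n w)                       ≡⟨ cong (λ y → + n ℤ.* x ℤ.+ + y) (sum-applyUpTo-* (suc k) (_/ w) n) ⟨
    + n ℤ.* x ℤ.+ + sum (applyUpTo (λ j → suc k * (j / w)) n)       ≡⟨ sumℤ-applyUpTo-offset x (λ j → suc k * (j / w)) n ⟨
    sumℤ (applyUpTo (λ j → x ℤ.+ + (suc k * (j / w))) n)            ≤⟨ sumℤ-applyUpTo-mono-≤ _ d n (windowCount≤⇒staircase≤ d n k w (entry-mono-≤ x xs D↗) count≤w′) ⟩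
    sumℤ (applyUpTo d n)                                            ≡⟨ cong sumℤ (applyUpTo-entry x xs) ⟩
    sumℤ (x ∷ xs)                                                   ∎)
  where
  open ℤ.≤-Reasoning
  n = suc (length xs)
  d = entry x xs
  count≤w′ : ∀ b → windowCount (applyUpTo d n) k b ≤ w
  count≤w′ b = subst (λ E → windowCount E k b ≤ w) (sym (applyUpTo-entry x xs)) (count≤w _ (b , refl))
  instance
    w≢0 : NonZero w
    -- The window starting at the first term `x` contains that term, so w ≥ 1.
    w≢0 = ℕ.>-nonZero (≤-trans
      (length-filter-applyUpTo-≥ (inWindow? x k) d n 0 1 (s≤s z≤n)
        λ { zero _ _ → ℤ.≤-refl , ℤ.i≤i+j x (+ k) ; (suc _) _ (s≤s ()) })
      (count≤w′ x))

module _ (n k s e : ℕ) .{{_ : NonZero n}} .{{_ : NonZero s}} (δ : ℤ) where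

  private
    offset : ℕ → ℕ
    offset j = suc k * (j / s) + bump n e j

    term : ℕ → ℤ
    term j = δ ℤ.+ + offset j

    offset-mono-≤ : ∀ {i j} → i ≤ j → offset i ≤ offset j
    offset-mono-≤ i≤j = +-mono-≤ (*-monoʳ-≤ (suc k) (/-monoˡ-≤ s i≤j)) (bump-mono-≤ n e i≤j)

    offset-spread : ∀ i j → i + s ≤ j → offset i + suc k ≤ offset j
    offset-spread i j i+s≤j = begin
      suc k * (i / s) + bump n e i + suc k       ≡⟨ lemma (suc k) (i / s) (bump n e i) ⟩
      suc k * suc (i / s) + bump n e i           ≡⟨ cong (λ x → suc k * x + bump n e i) ([n+m]/n≡1+m/n s i) ⟨
      suc k * ((s + i) / s) + bump n e i         ≤⟨ +-mono-≤ (*-monoʳ-≤ (suc k) (/-monoˡ-≤ s (subst (_≤ j) (+-comm i s) i+s≤j)))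
                                                             (bump-mono-≤ n e (≤-trans (m≤m+n i s) i+s≤j)) ⟩
      offset j                                   ∎
      where
      open ≤-Reasoning
      lemma : ∀ h q b → h * q + b + h ≡ h * suc q + b
      lemma = solve-∀

    offset-0 : offset 0 ≡ 0
    offset-0 = begin
      -- Since n ≥ 1, the last index differs from index 0, so the first term stays δ.
      suc k * (0 / s) + bump n e 0 ≡⟨ cong₂ (λ x y → suc k * x + y) (0/n≡0 s) (bump-< n e (ℕ.>-nonZero⁻¹ n)) ⟩
      suc k * 0 + 0                ≡⟨ cong (λ x → x + 0) (*-zeroʳ (suc k)) ⟩
      0                            ∎
      where open ≡-Reasoning

  -- The staircase δ + h ⌊j / s⌋ with the excess e put on its last term.
  raisedStaircase : List ℤ
  raisedStaircase = applyUpTo term (suc n)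

  raisedStaircase-isδSequence : IsδSequence δ (suc n) raisedStaircase
  raisedStaircase-isδSequence = record
    { length≡ = length-applyUpTo term (suc n)
    ; sorted  = applyUpTo⁺₂ ℤ.≤-totalOrder term (suc n)
                  (λ i → ℤ.+-monoʳ-≤ δ (ℤ.+≤+ (offset-mono-≤ (n≤1+n i))))
    ; first   = cong just (trans (cong (λ x → δ ℤ.+ + x) offset-0) (ℤ.+-identityʳ δ))
    }

  sumℤ-raisedStaircase :
    sumℤ raisedStaircase ≡ + suc n ℤ.* δ ℤ.+ + (suc k * quotientSum (suc n) s + e)
  sumℤ-raisedStaircase = trans (sumℤ-applyUpTo-offset δ offset (suc n))
    (cong (λ x → + suc n ℤ.* δ ℤ.+ + x) (begin
      sum (applyUpTo offset (suc n))
        ≡⟨ sum-applyUpTo-+ (λ j → suc k * (j / s)) (bump n e) (suc n) ⟩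
      sum (applyUpTo (λ j → suc k * (j / s)) (suc n)) + sum (applyUpTo (bump n e) (suc n))
        ≡⟨ cong₂ _+_ (sum-applyUpTo-* (suc k) (_/ s) (suc n)) (sum-bump n e) ⟩
      suc k * quotientSum (suc n) s + e ∎))
    where open ≡-Reasoning

  -- The window starting at δ holds the first `s` terms. If s ≤ n they avoid the raised last term
  -- and all equal δ; if s = n + 1 they include it, and e ≤ k keeps it inside the window.
  raisedStaircase-windowNumber : s ≤ suc n → (s ≤ n ⊎ e ≤ k) →
    IsWindowNumber raisedStaircase k s
  raisedStaircase-windowNumber s≤1+n s≤n⊎e≤k =
    (δ , ≤-antisym (count≤s δ) (length-filter-applyUpTo-≥ (inWindow? δ k) term (suc n) 0 s s≤1+n inWindow)) ,
    λ { _ (a , refl) → count≤s a }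
    where
    count≤s : ∀ a → windowCount raisedStaircase k a ≤ s
    count≤s = spread⇒windowCount≤ term (suc n) k s λ i j i+s≤j →
      subst (ℤ._≤ term j) (sym (ℤ.+-assoc δ (+ offset i) (+ suc k)))
        (ℤ.+-monoʳ-≤ δ (ℤ.+≤+ (offset-spread i j i+s≤j)))

    bump≤k : ∀ {j} → j < s → bump n e j ≤ k
    bump≤k {j} j<s =
      [ (λ s≤n → subst (_≤ k) (sym (bump-< n e (<-≤-trans j<s s≤n))) z≤n)
      , ≤-trans (bump≤ n e j) ]′ s≤n⊎e≤k

    offset≤k : ∀ {j} → j < s → offset j ≤ k
    offset≤k {j} j<s = begin
      suc k * (j / s) + bump n e j   ≡⟨ cong (λ x → suc k * x + bump n e j) (m<n⇒m/n≡0 j<s) ⟩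
      suc k * 0 + bump n e j         ≡⟨ cong (λ x → x + bump n e j) (*-zeroʳ (suc k)) ⟩
      bump n e j                     ≤⟨ bump≤k j<s ⟩
      k                              ∎
      where open ≤-Reasoning

    inWindow : ∀ j → 0 ≤ j → j < s → InWindow δ k (δ ℤ.+ + offset j)
    inWindow j _ j<s = ℤ.i≤i+j δ (+ offset j) , ℤ.+-monoʳ-≤ δ (ℤ.+≤+ (offset≤k j<s))

-- Feasibility and the ceilings, in terms of M = 2m - nδ

feasible? : ∀ n m δ k → Decidable (Feasible n m δ k)
feasible? n m δ k zero      = no λ ()
feasible? n m δ k s@(suc _) = map′ (λ p → _ , p) proj₂
  (s ≤? n ×-dec staircaseSum δ k n s ℤ.≤? + 2 ℤ.* m)

module _ (n k M : ℕ) (δ m : ℤ) (2m≡nδ+M : + 2 ℤ.* m ≡ + n ℤ.* δ ℤ.+ + M) where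

  staircaseSum≡ : ∀ s .{{_ : NonZero s}} →
    staircaseSum δ k n s ≡ + n ℤ.* δ ℤ.+ + (suc k * quotientSum n s)
  staircaseSum≡ s = cong (λ qs → + n ℤ.* δ ℤ.+ + (suc k * sum qs)) (map-upTo (_/ s) n)

  quotientSum≤⇒feasible : ∀ s .{{_ : NonZero s}} → s ≤ n → suc k * quotientSum n s ≤ M →
    Feasible n m δ k s
  quotientSum≤⇒feasible s@(suc _) s≤n le = _ , s≤n ,
    subst₂ ℤ._≤_ (sym (staircaseSum≡ s)) (sym 2m≡nδ+M) (ℤ.+-monoʳ-≤ (+ n ℤ.* δ) (ℤ.+≤+ le))

  feasible⇒quotientSum≤ : ∀ s .{{_ : NonZero s}} → Feasible n m δ k s → suc k * quotientSum n s ≤ M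
  feasible⇒quotientSum≤ s@(suc _) (_ , _ , le) = ≮⇒≥ λ M<hS →
    ℤ.<⇒≱ (ℤ.+-monoʳ-< (+ n ℤ.* δ) (ℤ.+<+ M<hS)) (subst₂ ℤ._≤_ (staircaseSum≡ s) 2m≡nδ+M le)

  module _ (t : ℕ) .{{_ : NonZero t}} where

    private
      denominator : ℕ
      denominator = suc k * (t * suc t)

      instance
        t[1+t]≢0 : NonZero (t * suc t)
        t[1+t]≢0 = m*n≢0 t (suc t)

        denominator≢0 : NonZero denominator
        denominator≢0 = m*n≢0 (suc k) (t * suc t)

      -- The two occurrences of nδ cancel, which leaves a difference of natural numbers.
      numerator≡ : + 2 ℤ.* (+ n ℤ.* (δ ℤ.+ + (t * suc k)) ℤ.- + 2 ℤ.* m) ≡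
                   + (2 * (n * (t * suc k))) ℤ.- + (2 * M)
      numerator≡ = begin
        + 2 ℤ.* (+ n ℤ.* (δ ℤ.+ + (t * suc k)) ℤ.- + 2 ℤ.* m)
          ≡⟨ cong (λ x → + 2 ℤ.* (+ n ℤ.* (δ ℤ.+ + (t * suc k)) ℤ.- x)) 2m≡nδ+M ⟩
        + 2 ℤ.* (+ n ℤ.* (δ ℤ.+ + (t * suc k)) ℤ.- (+ n ℤ.* δ ℤ.+ + M))
          ≡⟨ lemma (+ n) δ (+ (t * suc k)) (+ M) ⟩
        + 2 ℤ.* (+ n ℤ.* + (t * suc k)) ℤ.- + 2 ℤ.* + M
          ≡⟨ cong (λ x → + 2 ℤ.* x ℤ.- + 2 ℤ.* + M) (ℤ.pos-* n (t * suc k)) ⟨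
        + 2 ℤ.* + (n * (t * suc k)) ℤ.- + 2 ℤ.* + M
          ≡⟨ cong₂ ℤ._-_ (ℤ.pos-* 2 (n * (t * suc k))) (ℤ.pos-* 2 M) ⟨
        + (2 * (n * (t * suc k))) ℤ.- + (2 * M) ∎
        where
        open ≡-Reasoning
        lemma : ∀ n δ c M → + 2 ℤ.* (n ℤ.* (δ ℤ.+ c) ℤ.- (n ℤ.* δ ℤ.+ M)) ≡
                            + 2 ℤ.* (n ℤ.* c) ℤ.- + 2 ℤ.* M
        lemma = ℤ.solve-∀

      [c*d+2M]-2M≡c*d : ∀ c → + (c * denominator + 2 * M) ℤ.- + (2 * M) ≡ + c ℤ.* + denominator
      [c*d+2M]-2M≡c*d c = trans (lemma (+ (c * denominator)) (+ (2 * M))) (ℤ.pos-* c denominator)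
        where
        lemma : ∀ a b → a ℤ.+ b ℤ.- b ≡ a
        lemma = ℤ.solve-∀

    ceiling-f-≤ : ∀ c → 2 * (n * (t * suc k)) ≤ c * (suc k * (t * suc t)) + 2 * M →
      ceiling (f t n m δ k) ℤ.≤ + c
    ceiling-f-≤ c le = ceiling-≤ _ denominator (+ c)
      (subst₂ ℤ._≤_ (sym numerator≡) ([c*d+2M]-2M≡c*d c) (ℤ.+-monoˡ-≤ (ℤ.- + (2 * M)) (ℤ.+≤+ le)))

    <-ceiling-f : ∀ c → c * (suc k * (t * suc t)) + 2 * M < 2 * (n * (t * suc k)) →
      + c ℤ.< ceiling (f t n m δ k)
    <-ceiling-f c lt = <-ceiling _ denominator (+ c)
      (subst₂ ℤ._<_ ([c*d+2M]-2M≡c*d c) (sym numerator≡) (ℤ.+-monoˡ-< (ℤ.- + (2 * M)) (ℤ.+<+ lt)))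

  -- Multiply 2nt ≤ 2S + st(t + 1) by h and use hS ≤ M.
  feasible⇒ceilings≤ : ∀ {s} → Feasible n m δ k s → ∀ c → c ∈ Ceilings n m δ k → c ℤ.≤ + s
  feasible⇒ceilings≤ {s} feas@(s≢0 , _) _ (t , t≢0 , refl) = ceiling-f-≤ t {{t≢0}} s (begin
    2 * (n * (t * h))                      ≡⟨ lemma₁ h n t ⟩
    h * (2 * (n * t))                      ≤⟨ *-monoʳ-≤ h (2nt≤2quotientSum+st[1+t] s {{s≢0}} n t) ⟩
    h * (2 * S + s * (t * suc t))          ≡⟨ lemma₂ h s S (t * suc t) ⟩
    s * (h * (t * suc t)) + 2 * (h * S)    ≤⟨ +-monoʳ-≤ (s * (h * (t * suc t))) (*-monoʳ-≤ 2 (feasible⇒quotientSum≤ s {{s≢0}} feas)) ⟩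
    s * (h * (t * suc t)) + 2 * M          ∎)
    where
    open ≤-Reasoning
    h = suc k
    S = quotientSum n s {{s≢0}}
    lemma₁ : ∀ h n t → 2 * (n * (t * h)) ≡ h * (2 * (n * t))
    lemma₁ = solve-∀
    lemma₂ : ∀ h s S a → h * (2 * S + s * a) ≡ s * (h * a) + 2 * (h * S)
    lemma₂ = solve-∀

  -- At t = ⌊n / s⌋ the block inequality is an equality, so hS > M makes f_t exceed `s`. This `t` is
  -- positive because s ≤ n.
  infeasible⇒<-ceiling : ∀ s .{{_ : NonZero s}} → s ≤ n → ¬ Feasible n m δ k s →
    ∃[ c ] c ∈ Ceilings n m δ k × + s ℤ.< c
  infeasible⇒<-ceiling s s≤n ¬feas = _ , (t , t≢0 , refl) , <-ceiling-f t {{t≢0}} s (begin-strict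
    s * (h * (t * suc t)) + 2 * M          <⟨ +-monoʳ-< (s * (h * (t * suc t))) (*-monoʳ-< 2 (≰⇒> (¬feas ∘ quotientSum≤⇒feasible s s≤n))) ⟩
    s * (h * (t * suc t)) + 2 * (h * S)    ≡⟨ lemma₁ h s S (t * suc t) ⟩
    h * (2 * S + s * (t * suc t))          ≡⟨ cong (λ x → h * x) (2nq≡2quotientSum+sq[1+q] s n) ⟨
    h * (2 * (n * t))                      ≡⟨ lemma₂ h n t ⟩
    2 * (n * (t * h))                      ∎)
    where
    open ≤-Reasoning
    h = suc k
    S = quotientSum n s
    t = n / s
    t≢0 : NonZero t
    t≢0 = ℕ.>-nonZero (m≥n⇒m/n>0 s≤n)
    lemma₁ : ∀ h s S a → s * (h * a) + 2 * (h * S) ≡ h * (2 * S + s * a)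
    lemma₁ = solve-∀
    lemma₂ : ∀ h n t → h * (2 * (n * t)) ≡ 2 * (n * (t * h))
    lemma₂ = solve-∀

  -- The value f_t is positive as soon as nth > M, and t = M + 1 achieves this because n and h are
  -- at least 1.
  ∃-positive-ceiling : .{{_ : NonZero n}} → ∃[ c ] c ∈ Ceilings n m δ k × 0ℤ ℤ.< c
  ∃-positive-ceiling = _ , (suc M , _ , refl) , <-ceiling-f (suc M) 0
    (*-monoʳ-< 2 (≤-trans (m≤m*n (suc M) (suc k)) (m≤n*m (suc M * suc k) n)))

  -- By minimality s - 1 is infeasible, so some ceiling exceeds it. For s = 1 the predecessor 0 is
  -- not an admissible width, and a positive ceiling is used instead.
  ∃-ceiling≥least : .{{_ : NonZero n}} → ∀ {s} → IsLeast _≤_ (Feasible n m δ k) s →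
    ∃[ c ] c ∈ Ceilings n m δ k × + s ℤ.≤ c
  ∃-ceiling≥least {suc zero}      _ = map₂ (map₂ ℤ.i<j⇒suc[i]≤j) ∃-positive-ceiling
  ∃-ceiling≥least {suc s@(suc _)} ((_ , s<n , _) , s-least) = map₂ (map₂ ℤ.i<j⇒suc[i]≤j)
    (infeasible⇒<-ceiling s (<⇒≤ s<n) λ feas → <-irrefl refl (s-least s feas))

  least-isGreatestCeiling : .{{_ : NonZero n}} → ∀ {s} → IsLeast _≤_ (Feasible n m δ k) s →
    IsGreatest ℤ._≤_ (Ceilings n m δ k) (+ s)
  least-isGreatestCeiling {s} s-least@(feas , _) with ∃-ceiling≥least s-least
  ... | c , c∈ , s≤c = subst (_∈ Ceilings n m δ k) (ℤ.≤-antisym (feasible⇒ceilings≤ feas c c∈) s≤c) c∈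
                     , feasible⇒ceilings≤ feas

  windowNumber⇒feasible : .{{_ : NonZero n}} → ∀ {w} → WindowNumbers n m δ k w → Feasible n m δ k w
  windowNumber⇒feasible {w} (D , D-δ , ΣD≡2m , isWN)
    with w≢0 , w≤n , le ← windowNumber⇒staircaseSum≤ k w D-δ isWN =
    w≢0 , w≤n , subst₂ ℤ._≤_ (sym (staircaseSum≡ w {{w≢0}})) ΣD≡2m le

-- Attaining the least feasible value as a window number

least⇒windowNumber : ∀ n k M .{{_ : NonZero n}} δ m →
  + 2 ℤ.* m ≡ + suc n ℤ.* δ ℤ.+ + M → ∀ {s} → IsLeast _≤_ (Feasible (suc n) m δ k) s →
  WindowNumbers (suc n) m δ k s
least⇒windowNumber n k M δ m 2m≡ {s} (feas@(s≢0 , s≤1+n , _) , s-least) =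
  raisedStaircase n k s e δ ,
  raisedStaircase-isδSequence n k s e δ ,
  trans (sumℤ-raisedStaircase n k s e δ)
    (trans (cong (λ x → + suc n ℤ.* δ ℤ.+ + x) (m+[n∸m]≡n le)) (sym 2m≡)) ,
  raisedStaircase-windowNumber n k s e δ s≤1+n s≤n⊎e≤k
  where
  instance _ = s≢0
  le : suc k * quotientSum (suc n) s ≤ M
  le = feasible⇒quotientSum≤ (suc n) k M δ m 2m≡ s feas
  e = M ∸ suc k * quotientSum (suc n) s
  quotientSum[1+n,n]≡1 : quotientSum (suc n) n ≡ 1
  quotientSum[1+n,n]≡1 = begin
    quotientSum (suc n) n   ≡⟨ cong (λ x → quotientSum x n) (+-comm n 1) ⟨
    quotientSum (n + 1) n   ≡⟨ quotientSum-+ 1 n ⟩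
    suc (0 / n + 0)         ≡⟨ cong suc (cong (λ x → x + 0) (0/n≡0 n)) ⟩
    1                       ∎
    where open ≡-Reasoning
  -- With n + 1 terms and width `n` only the last term climbs a step, so `n` is feasible once M ≥ k
  -- + 1. A least `s` above `n` therefore forces M ≤ k, and e ≤ M.
  M≤k : n < s → M ≤ k
  M≤k n<s = ≮⇒≥ λ k<M → <⇒≱ n<s (s-least n (quotientSum≤⇒feasible (suc n) k M δ m 2m≡ n (n≤1+n n)
    (subst (_≤ M) (sym (trans (cong (λ x → suc k * x) quotientSum[1+n,n]≡1) (*-identityʳ (suc k)))) k<M)))
  s≤n⊎e≤k : s ≤ n ⊎ e ≤ k
  s≤n⊎e≤k with s ≤? n
  ... | yes s≤n = inj₁ s≤n
  ... | no  s≰n = inj₂ (≤-trans (m∸n≤m M (suc k * quotientSum (suc n) s)) (M≤k (≰⇒> s≰n)))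

theorem8 : (n : ℕ) (δ : ℤ) (k : ℕ) (m : ℤ) →
    2 ℕ.≤ n → 0ℤ ℤ.≤ δ → + n ℤ.* δ ℤ.≤ + 2 ℤ.* m →
    ∃[ s ] ( IsGreatest ℤ._≤_ (Ceilings n m δ k) (+ s)
    × IsLeast ℕ._≤_ (Feasible n m δ k) s
    × IsLeast ℕ._≤_ (WindowNumbers n m δ k) s )
theorem8 1 _ _ _ (s≤s ()) _ _
theorem8 n@(suc n′@(suc _)) δ k m _ _ nδ≤2m =
  s , least-isGreatestCeiling n k M δ m 2m≡nδ+M s-least , s-least ,
  least⇒windowNumber n′ k M δ m 2m≡nδ+M s-least ,
  λ w w∈ → proj₂ s-least w (windowNumber⇒feasible n k M δ m 2m≡nδ+M w∈)
  where
  M : ℕ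
  M = ℤ.∣ + 2 ℤ.* m ℤ.- + n ℤ.* δ ∣
  2m≡nδ+M : + 2 ℤ.* m ≡ + n ℤ.* δ ℤ.+ + M
  2m≡nδ+M = begin
    + 2 ℤ.* m                                          ≡⟨ lemma (+ 2 ℤ.* m) (+ n ℤ.* δ) ⟩
    + n ℤ.* δ ℤ.+ (+ 2 ℤ.* m ℤ.- + n ℤ.* δ)  ≡⟨ cong (λ x → + n ℤ.* δ ℤ.+ x) (ℤ.0≤i⇒+∣i∣≡i (ℤ.i≤j⇒0≤j-i nδ≤2m)) ⟨
    + n ℤ.* δ ℤ.+ + M                                  ∎
    where
    open ≡-Reasoning
    lemma : ∀ a b → a ≡ b ℤ.+ (a ℤ.- b)
    lemma = ℤ.solve-∀
  -- At width `n` all quotients vanish; this gives the search for the least feasible value its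
  -- starting point.
  n-feasible : Feasible n m δ k n
  n-feasible = quotientSum≤⇒feasible n k M δ m 2m≡nδ+M n ≤-refl (≤-trans (≤-reflexive
    (trans (cong (λ x → suc k * x) (quotientSum-≤ n n ≤-refl)) (*-zeroʳ (suc k)))) z≤n)
  least-feasible = least (feasible? n m δ k) n n-feasible
  s = proj₁ least-feasible
  s-least = proj₂ least-feasible
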